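{- For all integers $n\geq 0$, $p_{\mathrm{eu}}^{\mathrm{od}}(n)\leq p^{\mathrm{ed}}_{\mathrm{ou}}(n)$. Moreover, $p_{\mathrm{eu}}^{\mathrm{od}}(n)< p^{\mathrm{ed}}_{\mathrm{ou}}(n)$ for all $n\geq 2$.
   Context: A partition of a non-negative integer $n$ is a non-increasing (finite, possibly empty) sequence of positive integers, called parts, summing to $n$. $p_{\mathrm{eu}}^{\mathrm{od}}(n)$ is the number of partitions of $n$ in which every odd part is larger than every even part, the odd parts are pairwise distinct, and the even parts are unrestricted (may be repeated). $p^{\mathrm{ed}}_{\mathrm{ou}}(n)$ is the number of partitions of $n$ in which every even part is larger than every odd part, the even parts are pairwise distinct, and the odd parts are unrestricted (may be repeated). In both cases partitions with no even parts or with no odd parts are allowed. -}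

module Defs where

open import Data.List.Base using (List; []; _∷_; length; map; filter; upTo; cartesianProductWith)
open import Data.List.Properties using (∷-injective)
open import Data.List.Membership.Propositional using (_∈_)
open import Data.List.Membership.Propositional.Properties
  using (∈-map⁺; ∈-upTo⁺; ∈-filter⁺; ∈-filter⁻; ∈-cartesianProductWith⁺; ∈-cartesianProductWith⁻)
open import Data.List.Relation.Unary.All as All using (All; []; _∷_)
open import Data.List.Relation.Unary.AllPairs using ([]; _∷_)
open import Data.List.Relation.Unary.Any using (here; there)
open import Data.List.Relation.Unary.Linked using (Linked; linked?)
open import Data.List.Relation.Unary.Unique.Propositional using (Unique)
import Data.List.Relation.Unary.Unique.Propositional.Properties as Unique
open import Data.Nat.Base using (ℕ; zero; suc; _+_; _≤_; _<_; _≥_; z≤n; s≤s)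
open import Data.Nat.Divisibility using (_∣_; _∣?_)
open import Data.Nat.ListAction using (sum)
open import Data.Nat.Properties
  using (_≟_; _<?_; _≥?_; ≤-trans; +-mono-≤; m≤m+n; m≤n+m; suc-injective)
open import Data.List.Relation.Unary.Unique.DecPropositional _≟_ using (unique?)
open import Data.Product.Base using (_×_; _,_; proj₁; proj₂; uncurry)
open import Function.Bundles using (_⇔_; mk⇔)
open import Level using (0ℓ)
open import Relation.Binary.PropositionalEquality using (_≡_; refl)
open import Relation.Nullary using (¬_; ¬?; Dec)
open import Relation.Nullary.Decidable using (map′; _×-dec_)
open import Relation.Unary using (Pred; Decidable)

record IsPartition (n : ℕ) (xs : List ℕ) : Set where
  constructor isPartition
  field
    nonIncreasing : Linked _≥_ xs
    positive      : All (0 <_) xs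
    sums          : sum xs ≡ n

isPartition? : ∀ n → Decidable (IsPartition n)
isPartition? n xs =
  map′ (λ (d , p , s) → isPartition d p s)
       (λ (isPartition d p s) → d , p , s)
       (linked? _≥?_ xs ×-dec All.all? (0 <?_) xs ×-dec sum xs ≟ n)

Even Odd : Pred ℕ 0ℓ
Even m = 2 ∣ m
Odd  m = ¬ Even m

even? : Decidable Even
even? m = 2 ∣? m

odd? : Decidable Odd
odd? m = ¬? (even? m)

evenParts oddParts : List ℕ → List ℕ
evenParts = filter even?
oddParts  = filter odd?

infix 4 _≫_
_≫_ : List ℕ → List ℕ → Set
xs ≫ ys = All (λ x → All (λ y → y < x) ys) xs

_≫?_ : ∀ xs ys → Dec (xs ≫ ys)
xs ≫? ys = All.all? (λ x → All.all? (_<? x) ys) xs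

OdEu EdOu : Pred (List ℕ) 0ℓ
OdEu xs = oddParts xs ≫ evenParts xs × Unique (oddParts xs)
EdOu xs = evenParts xs ≫ oddParts xs × Unique (evenParts xs)

odEu? : Decidable OdEu
odEu? xs = (oddParts xs ≫? evenParts xs) ×-dec unique? (oddParts xs)

edOu? : Decidable EdOu
edOu? xs = (evenParts xs ≫? oddParts xs) ×-dec unique? (evenParts xs)

-- All lists of length at most l with entries drawn from as.
listsUpTo : ℕ → List ℕ → List (List ℕ)
listsUpTo zero    as = [] ∷ []
listsUpTo (suc l) as = [] ∷ cartesianProductWith _∷_ as (listsUpTo l as)

-- A partition of n has at most n parts, each between 1 and n, so this search
-- is exhaustive: see ∈-partitions and partitions-unique below.
partitions : ℕ → List (List ℕ)
partitions n = filter (isPartition? n) (listsUpTo n (map suc (upTo n)))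

#partitions : {P : Pred (List ℕ) 0ℓ} → Decidable P → ℕ → ℕ
#partitions P? n = length (filter P? (partitions n))

pᵒᵈₑᵤ pᵉᵈₒᵤ : ℕ → ℕ
pᵒᵈₑᵤ = #partitions odEu?
pᵉᵈₒᵤ = #partitions edOu?

private
  ∈-listsUpTo : ∀ l {as xs} → length xs ≤ l → All (_∈ as) xs → xs ∈ listsUpTo l as
  ∈-listsUpTo zero    z≤n     []        = here refl
  ∈-listsUpTo (suc l) z≤n     []        = here refl
  ∈-listsUpTo (suc l) (s≤s h) (x∈ ∷ xs∈) =
    there (∈-cartesianProductWith⁺ _∷_ x∈ (∈-listsUpTo l h xs∈))

  listsUpTo-unique : ∀ l {as} → Unique as → Unique (listsUpTo l as)
  listsUpTo-unique zero    u = [] ∷ []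
  listsUpTo-unique (suc l) {as} u =
    All.tabulate nonEmpty
      ∷ Unique.cartesianProductWith⁺ _∷_ ∷-injective u (listsUpTo-unique l u)
    where
    nonEmpty : ∀ {ys} → ys ∈ cartesianProductWith _∷_ as (listsUpTo l as) → ¬ ([] ≡ ys)
    nonEmpty ys∈ refl with ∈-cartesianProductWith⁻ _∷_ as (listsUpTo l as) ys∈
    ... | _ , _ , _ , _ , ()

  length≤sum : ∀ {xs} → All (0 <_) xs → length xs ≤ sum xs
  length≤sum []       = z≤n
  length≤sum (p ∷ ps) = +-mono-≤ p (length≤sum ps)

  parts≤sum : ∀ xs → All (_≤ sum xs) xs
  parts≤sum []       = []
  parts≤sum (x ∷ xs) =
    m≤m+n x (sum xs) ∷ All.map (λ h → ≤-trans h (m≤n+m (sum xs) x)) (parts≤sum xs)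

  inRange : ∀ {m n} → 0 < m → m ≤ n → m ∈ map suc (upTo n)
  inRange {suc m} _ m<n = ∈-map⁺ suc (∈-upTo⁺ m<n)

∈-partitions : ∀ {n xs} → xs ∈ partitions n ⇔ IsPartition n xs
∈-partitions {n} {xs} = mk⇔
  (λ xs∈ → proj₂ (∈-filter⁻ (isPartition? n) {xs = listsUpTo n (map suc (upTo n))} xs∈))
  complete
  where
  complete : IsPartition n xs → xs ∈ partitions n
  complete π@(isPartition _ pos refl) = ∈-filter⁺ (isPartition? n)
    (∈-listsUpTo n (length≤sum pos)
      (All.zipWith (uncurry inRange) (pos , parts≤sum xs)))
    π

partitions-unique : ∀ n → Unique (partitions n)
partitions-unique n = Unique.filter⁺ (isPartition? n)
  (listsUpTo-unique n (Unique.map⁺ suc-injective (Unique.upTo⁺ n)))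

{-# OPTIONS --safe #-}
-- The injection subtracts 1 from every part x and adds one new part 1 for each
-- x.  This turns distinct odd parts o > 1 into distinct even parts o − 1, even
-- parts into odd ones, and keeps the two groups in the same order.
-- With l parts x > 1 and d ≤ 1 parts equal to 1, the image has 2 l + d parts, so
-- l and d, and hence the original partition, are read off the image.
-- For n ≥ 2 the one-part partition of n is not an image, as it has no part 1.
module Submission where

open import Defs
open import Data.Nat.Base using (ℕ; _≤_; _<_; _≥_)
open import Data.Product.Base using (_×_)

open import Data.List.Base
  using (List; []; _∷_; [_]; _++_; length; map; filter; replicate; take)
open import Data.List.Properties
  using (filter-accept; filter-reject; filter-++; filter-none; ++-identityʳ;
         length-++; length-++-sucʳ; length-map; length-replicate)
open import Data.List.Membership.Propositional using (_∈_)
open import Data.List.Membership.Propositional.Properties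
  using (∈-∃++; ∈-map⁻; ∈-filter⁺; ∈-filter⁻)
open import Data.List.Relation.Binary.Permutation.Propositional.Properties
  using (∈-resp-↭; shift)
open import Data.List.Relation.Binary.Subset.Propositional using (_⊆_)
open import Data.List.Relation.Unary.All as All using (All; []; _∷_)
import Data.List.Relation.Unary.All.Properties as All
open import Data.List.Relation.Unary.AllPairs as AllPairs using (AllPairs; []; _∷_)
import Data.List.Relation.Unary.AllPairs.Properties as AllPairs
open import Data.List.Relation.Unary.Any using (here; there)
open import Data.List.Relation.Unary.Linked using ([-])
open import Data.List.Relation.Unary.Linked.Properties using (AllPairs⇒Linked; Linked⇒AllPairs)
open import Data.List.Relation.Unary.Unique.Propositional using (Unique)
import Data.List.Relation.Unary.Unique.Propositional.Properties as Unique
open import Data.Nat.Base using (zero; suc; _+_; _∸_; ⌊_/2⌋; z≤n; s≤s; z<s)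
open import Data.Nat.Divisibility using (_∣0; ∣-refl; >⇒∤; ∣m∣n⇒∣m+n; ∣m+n∣m⇒∣n)
open import Data.Nat.ListAction using (sum)
open import Data.Nat.ListAction.Properties using (sum-++)
open import Data.Nat.Properties
  using (+-comm; +-suc; +-assoc; +-identityʳ; m+n∸m≡n; n≡⌊n+n/2⌋; n≡⌈n+n/2⌉; ≤-pred; ≤-refl; ≤-trans)
open import Data.Product.Base using (_,_)
open import Data.Sum.Base using (_⊎_; inj₁; inj₂; [_,_]′; swap)
open import Function.Base using (_∘_; flip; id)
open import Function.Bundles using (Equivalence)
open import Relation.Binary.PropositionalEquality
  using (_≡_; _≢_; refl; sym; trans; cong; cong₂; subst; module ≡-Reasoning)
open import Level using (0ℓ)
open import Relation.Nullary using (yes; no; contradiction)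
open import Relation.Unary using (Pred; Decidable)

-- Lists: counting without repetition, filtering and mapping.

module _ {A : Set} where

  -- Pigeonhole by induction: delete from `ys` one occurrence of the head `x`. The tail still lies
  -- in what is left, because `x` does not recur in it.
  Unique⊆⇒length≤ : {xs ys : List A} → Unique xs → xs ⊆ ys → length xs ≤ length ys
  Unique⊆⇒length≤ {[]} [] _ = z≤n
  Unique⊆⇒length≤ {x ∷ xs} (x∉xs ∷ xs!) sub with ∈-∃++ (sub (here refl))
  ... | as , bs , refl rewrite length-++-sucʳ as x bs = s≤s (Unique⊆⇒length≤ xs! sub′)
    where
    sub′ : xs ⊆ as ++ bs
    sub′ y∈xs with ∈-resp-↭ (shift x as bs) (sub (there y∈xs))
    ... | here refl = contradiction refl (All.lookup x∉xs y∈xs)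
    ... | there y∈  = y∈

  -- Applying `g` to the image gives back `xs`, so a repetition in the image would be one in `xs`.
  -- The inverse law is asked for on the entries of `xs` alone, since `untransfer` undoes `transfer`
  -- only on suitable partitions.
  Unique-map⁺ : {B : Set} {f : A → B} {g : B → A} {xs : List A} →
                All (λ x → g (f x) ≡ x) xs → Unique xs → Unique (map f xs)
  Unique-map⁺ {f = f} {g} {xs} inv xs! =
    Unique.map⁻ {f = g} (subst Unique (sym (map-inverse inv)) xs!)
    where
    map-inverse : ∀ {xs} → All (λ x → g (f x) ≡ x) xs → map g (map f xs) ≡ xs
    map-inverse []       = refl
    map-inverse (p ∷ ps) = cong₂ _∷_ p (map-inverse ps)

  AllPairs-++⁻ˡ : {R : A → A → Set} (xs : List A) {ys : List A} →
                  AllPairs R (xs ++ ys) → AllPairs R xs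
  AllPairs-++⁻ˡ []       _        = []
  AllPairs-++⁻ˡ (_ ∷ xs) (p ∷ ps) = All.++⁻ˡ xs p ∷ AllPairs-++⁻ˡ xs ps

  take-length-++ : (xs : List A) {ys : List A} → take (length xs) (xs ++ ys) ≡ xs
  take-length-++ []       = refl
  take-length-++ (x ∷ xs) = cong (x ∷_) (take-length-++ xs)

  filter-map : {B : Set} {f : A → B} {P : Pred B 0ℓ} {Q : Pred A 0ℓ}
               (P? : Decidable P) (Q? : Decidable Q) →
               (∀ {x} → P (f x) → Q x) → (∀ {x} → Q x → P (f x)) →
               ∀ xs → filter P? (map f xs) ≡ map f (filter Q? xs)
  filter-map P? Q? to from [] = refl
  filter-map {f = f} P? Q? to from (x ∷ xs) with Q? x
  ... | yes q = trans (filter-accept P? (from q)) (cong (f x ∷_) (filter-map P? Q? to from xs))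
  ... | no ¬q = trans (filter-reject P? (¬q ∘ to)) (filter-map P? Q? to from xs)

  AllPairs-filter-tail : {R : A → A → Set} {P : Pred A 0ℓ} (P? : Decidable P) {x : A} {xs : List A} →
                         AllPairs R (filter P? (x ∷ xs)) → AllPairs R (filter P? xs)
  AllPairs-filter-tail P? {x} ps with P? x
  ... | yes _ = AllPairs.tail ps
  ... | no  _ = ps

-- Parity under the successor.

even⊎even-suc : ∀ n → Even n ⊎ Even (suc n)
even⊎even-suc zero    = inj₁ (2 ∣0)
even⊎even-suc (suc n) = swap ([ inj₁ ∘ ∣m∣n⇒∣m+n ∣-refl , inj₂ ]′ (even⊎even-suc n))

odd-1 : Odd 1
odd-1 = >⇒∤ (s≤s (s≤s z≤n))

even⇒odd-suc : ∀ {n} → Even n → Odd (suc n)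
even⇒odd-suc {n} 2∣n 2∣1+n = odd-1 (∣m+n∣m⇒∣n (subst Even (+-comm 1 n) 2∣1+n) 2∣n)

odd⇒even-suc : ∀ {n} → Odd n → Even (suc n)
odd⇒even-suc {n} n-odd = [ flip contradiction n-odd , id ]′ (even⊎even-suc n)

oddParts-map-suc : ∀ xs → oddParts (map suc xs) ≡ map suc (evenParts xs)
oddParts-map-suc = filter-map odd? even?
  (λ {n} odd → [ id , flip contradiction odd ]′ (even⊎even-suc n)) even⇒odd-suc

evenParts-map-suc : ∀ xs → evenParts (map suc xs) ≡ map suc (oddParts xs)
evenParts-map-suc = filter-map even? odd? (flip even⇒odd-suc) odd⇒even-suc

-- Runs of ones, and the shape of the source partitions.

ones : ℕ → List ℕ
ones k = replicate k 1

evenParts-ones : ∀ k → evenParts (ones k) ≡ []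
evenParts-ones k = filter-none even? (All.replicate⁺ k odd-1)

evenParts-++-ones : ∀ xs k → evenParts (xs ++ ones k) ≡ evenParts xs
evenParts-++-ones xs k = trans (filter-++ even? xs (ones k))
  (trans (cong (evenParts xs ++_) (evenParts-ones k)) (++-identityʳ _))

sum-ones : ∀ k → sum (ones k) ≡ k
sum-ones zero    = refl
sum-ones (suc k) = cong suc (sum-ones k)

sum-map-suc : ∀ xs → sum (map suc xs) ≡ sum xs + length xs
sum-map-suc []       = refl
sum-map-suc (x ∷ xs) = begin
  suc (x + sum (map suc xs))      ≡⟨ cong (λ s → suc (x + s)) (sum-map-suc xs) ⟩
  suc (x + (sum xs + length xs))  ≡⟨ cong suc (+-assoc x (sum xs) (length xs)) ⟨
  suc (x + sum xs + length xs)    ≡⟨ +-suc (x + sum xs) (length xs) ⟨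
  x + sum xs + suc (length xs)    ∎
  where open ≡-Reasoning

-- The parts above 1 are stored already lowered, as `ys`; `d` counts the parts equal to 1. As an
-- indexed family, it puts the partition itself in this form when matched on.
data Split : List ℕ → Set where
  split : ∀ ys d → All (0 <_) ys → d ≤ 1 → Split (map suc ys ++ ones d)

-- The order puts all ones at the end, and as 1 is odd, distinctness of the odd parts leaves at most
-- one of them.
splitSorted : ∀ {xs} → AllPairs _≥_ xs → All (0 <_) xs → Unique (oddParts xs) → Split xs
splitSorted {[]}                  _ _              _               = split [] 0 [] z≤n
splitSorted {0 ∷ _}               _ (() ∷ _)       _
splitSorted {1 ∷ []}              _ _              _               = split [] 1 [] (s≤s z≤n)
splitSorted {1 ∷ 0 ∷ _}           _ (_ ∷ () ∷ _)   _
splitSorted {1 ∷ 1 ∷ _}           _ _              ((1≢1 ∷ _) ∷ _) = contradiction refl 1≢1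
splitSorted {1 ∷ suc (suc _) ∷ _} ((s≤s () ∷ _) ∷ _) _ _
splitSorted {suc (suc x) ∷ xs} (_ ∷ sorted) (_ ∷ pos) u
  with splitSorted sorted pos (AllPairs-filter-tail odd? {suc (suc x)} {xs} u)
... | split ys d ys>0 d≤1 = split (suc x ∷ ys) d (z<s ∷ ys>0) d≤1

-- The map and its left inverse.

lowerParts : List ℕ → List ℕ
lowerParts (suc (suc x) ∷ xs) = suc x ∷ lowerParts xs
-- In a partition only ones can follow from here on; lowered to 0, they are dropped.
lowerParts _                  = []

transfer : List ℕ → List ℕ
transfer xs = lowerParts xs ++ ones (length xs)

-- On an image of length `2 l + d` with `d ≤ 1`, `h` equals `l`: the first `h` entries are the
-- lowered parts, and the subtraction returns `d`.
untransfer : List ℕ → List ℕ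
untransfer zs = map suc (take h zs) ++ ones (length zs ∸ (h + h))
  where h = ⌊ length zs /2⌋

lowerParts-split : ∀ {ys} d → All (0 <_) ys → lowerParts (map suc ys ++ ones d) ≡ ys
lowerParts-split zero    []                     = refl
lowerParts-split (suc d) []                     = refl
lowerParts-split d       (_∷_ {suc y} _ ys>0)   = cong (suc y ∷_) (lowerParts-split d ys>0)

transfer-split : ∀ {ys} d → All (0 <_) ys →
                 transfer (map suc ys ++ ones d) ≡ ys ++ ones (length ys + d)
transfer-split {ys} d ys>0 = cong₂ (λ as k → as ++ ones k) (lowerParts-split d ys>0)
  (trans (length-++ (map suc ys)) (cong₂ _+_ (length-map suc ys) (length-replicate d)))

⌊l+[l+d]/2⌋≡l : ∀ l {d} → d ≤ 1 → ⌊ l + (l + d) /2⌋ ≡ l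
⌊l+[l+d]/2⌋≡l l z≤n       rewrite +-identityʳ l = sym (n≡⌊n+n/2⌋ l)
-- `⌈ n /2⌉` unfolds to `⌊ suc n /2⌋`, so the ceiling law is the case of odd length.
⌊l+[l+d]/2⌋≡l l (s≤s z≤n) rewrite +-comm l 1 | +-suc l l = sym (n≡⌈n+n/2⌉ l)

untransfer-++-ones : ∀ ys {d} → d ≤ 1 →
                     untransfer (ys ++ ones (length ys + d)) ≡ map suc ys ++ ones d
untransfer-++-ones ys {d} d≤1
  rewrite length-++ ys {ones (length ys + d)}
        | length-replicate (length ys + d) {1}
        | ⌊l+[l+d]/2⌋≡l (length ys) d≤1
        | take-length-++ ys {ones (length ys + d)}
        | sym (+-assoc (length ys) (length ys) d)
        | m+n∸m≡n (length ys + length ys) d = refl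

untransfer-transfer : ∀ {xs} → Split xs → untransfer (transfer xs) ≡ xs
untransfer-transfer (split ys d ys>0 d≤1) =
  trans (cong untransfer (transfer-split d ys>0)) (untransfer-++-ones ys d≤1)

-- An image has length `2 l + d`, which is 1 only for `l = 0` and `d = 1`; that image is `[ 1 ]`,
-- excluded by `n ≥ 2`.
transfer≢[n] : ∀ {n xs} → n ≥ 2 → Split xs → transfer xs ≢ [ n ]
transfer≢[n] n≥2 (split ys d ys>0 d≤1) eq =
  ++-ones≢[n] ys n≥2 d≤1 (trans (sym (transfer-split d ys>0)) eq)
  where
  ++-ones≢[n] : ∀ {n d} ys → n ≥ 2 → d ≤ 1 → ys ++ ones (length ys + d) ≢ [ n ]
  ++-ones≢[n] []           _         z≤n       ()
  ++-ones≢[n] []           (s≤s ())  (s≤s z≤n) refl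
  ++-ones≢[n] (_ ∷ [])     _         _         ()
  ++-ones≢[n] (_ ∷ _ ∷ _)  _         _         ()

-- The image is a partition of `n` of the required kind.

transfer-isPartition : ∀ {n xs} → Split xs → IsPartition n xs → IsPartition n (transfer xs)
transfer-isPartition {n} (split ys d ys>0 _) (isPartition sorted _ sums)
  rewrite transfer-split d ys>0 = isPartition
    -- Positivity of an entry of `ys` is literally `≥ 1`, so ones may follow it.
    (AllPairs⇒Linked (AllPairs.++⁺ ys-sorted (ones-sorted k) (All.map (All.replicate⁺ k) ys>0)))
    (All.++⁺ ys>0 (All.replicate⁺ k z<s))
    sum≡n
  where
  k = length ys + d

  ones-sorted : ∀ m → AllPairs _≥_ (ones m)
  ones-sorted zero    = []
  ones-sorted (suc m) = All.replicate⁺ m ≤-refl ∷ ones-sorted m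

  ys-sorted : AllPairs _≥_ ys
  ys-sorted = AllPairs.map ≤-pred (AllPairs.map⁻
    (AllPairs-++⁻ˡ (map suc ys) (Linked⇒AllPairs (flip ≤-trans) sorted)))

  open ≡-Reasoning
  sum≡n : sum (ys ++ ones k) ≡ n
  sum≡n = begin
    sum (ys ++ ones k)              ≡⟨ sum-++ ys (ones k) ⟩
    sum ys + sum (ones k)           ≡⟨ cong (sum ys +_) (sum-ones k) ⟩
    -- `length ys` of the ones restore what lowering removed; the other `d` are the original ones.
    sum ys + (length ys + d)        ≡⟨ +-assoc (sum ys) (length ys) d ⟨
    sum ys + length ys + d          ≡⟨ cong₂ _+_ (sum-map-suc ys) (sum-ones d) ⟨
    sum (map suc ys) + sum (ones d) ≡⟨ sum-++ (map suc ys) (ones d) ⟨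
    sum (map suc ys ++ ones d)      ≡⟨ sums ⟩
    n                               ∎

-- Since `suc` swaps parities, the rewrites turn both hypotheses into statements about `map suc` of
-- the even and odd parts of `ys`, and `suc` cancels. Only the added ones remain to be compared:
-- they lie below every positive even part.
transfer-EdOu : ∀ {xs} → Split xs → OdEu xs → EdOu (transfer xs)
transfer-EdOu (split ys d ys>0 _) (odd≫even , odd!)
  rewrite transfer-split d ys>0
        | evenParts-++-ones ys (length ys + d)
        | filter-++ odd? ys (ones (length ys + d))
        | evenParts-++-ones (map suc ys) d
        | evenParts-map-suc ys
        | filter-++ odd? (map suc ys) (ones d)
        | oddParts-map-suc ys
  = All.zipWith (λ (p , q) → All.++⁺ p q) (even≫odd , even≫ones) ,
    Unique.map⁻ (AllPairs-++⁻ˡ (map suc (evenParts ys)) odd!)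
  where
  even≫odd : evenParts ys ≫ oddParts ys
  even≫odd = All.map (All.map ≤-pred ∘ All.map⁻) (All.map⁻ (All.++⁻ˡ _ odd≫even))

  even>1 : ∀ {m} → 0 < m → Even m → 1 < m
  even>1 {1}           _ e = contradiction e odd-1
  even>1 {suc (suc _)} _ _ = s≤s z<s

  even≫ones : evenParts ys ≫ oddParts (ones (length ys + d))
  even≫ones = All.zipWith
    (λ (m>0 , e) → All.filter⁺ odd? (All.replicate⁺ (length ys + d) (even>1 m>0 e)))
    (All.filter⁺ even? ys>0 , All.all-filter even? ys)

-- A single part leaves one of the two parity classes empty.
[n]-EdOu : ∀ n → EdOu [ n ]
[n]-EdOu n with even? n
... | yes e rewrite filter-reject odd? {xs = []} (λ o → o e) | filter-accept even? {xs = []} e =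
  [] ∷ [] , [] ∷ []
... | no  o rewrite filter-reject even? {xs = []} o = [] , []

-- Comparison of the two counts.

module _ (n : ℕ) where

  odEus edOus : List (List ℕ)
  odEus = filter odEu? (partitions n)
  edOus = filter edOu? (partitions n)

  ∈-odEus⁻ : ∀ {xs} → xs ∈ odEus → IsPartition n xs × OdEu xs
  ∈-odEus⁻ xs∈ with xs∈ps , odEu ← ∈-filter⁻ odEu? xs∈ = Equivalence.to ∈-partitions xs∈ps , odEu

  ∈-edOus⁺ : ∀ {xs} → IsPartition n xs → EdOu xs → xs ∈ edOus
  ∈-edOus⁺ π edOu = ∈-filter⁺ edOu? (Equivalence.from ∈-partitions π) edOu

  odEu-split : ∀ {xs} → xs ∈ odEus → Split xs
  odEu-split xs∈ with isPartition sorted pos _ , _ , odd! ← ∈-odEus⁻ xs∈ =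
    splitSorted (Linked⇒AllPairs (flip ≤-trans) sorted) pos odd!

  transfer-odEus! : Unique (map transfer odEus)
  transfer-odEus! = Unique-map⁺ {g = untransfer}
    (All.tabulate (untransfer-transfer ∘ odEu-split))
    (Unique.filter⁺ odEu? (partitions-unique n))

  transfer-odEus⊆edOus : map transfer odEus ⊆ edOus
  transfer-odEus⊆edOus zs∈ with xs , xs∈ , refl ← ∈-map⁻ transfer zs∈ =
    let π , odEu = ∈-odEus⁻ xs∈; s = odEu-split xs∈ in
    ∈-edOus⁺ (transfer-isPartition s π) (transfer-EdOu s odEu)

  pᵒᵈₑᵤ≤pᵉᵈₒᵤ : pᵒᵈₑᵤ n ≤ pᵉᵈₒᵤ n
  pᵒᵈₑᵤ≤pᵉᵈₒᵤ = subst (_≤ pᵉᵈₒᵤ n) (length-map transfer odEus)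
    (Unique⊆⇒length≤ transfer-odEus! transfer-odEus⊆edOus)

  pᵒᵈₑᵤ<pᵉᵈₒᵤ : n ≥ 2 → pᵒᵈₑᵤ n < pᵉᵈₒᵤ n
  pᵒᵈₑᵤ<pᵉᵈₒᵤ n≥2 = subst (λ l → suc l ≤ pᵉᵈₒᵤ n) (length-map transfer odEus)
    -- Strictness is the same count with `[ n ]` put in front of the image as one more element.
    (Unique⊆⇒length≤ ([n]∉image ∷ transfer-odEus!) [n]∷image⊆edOus)
    where
    [n]∉image : All ([ n ] ≢_) (map transfer odEus)
    [n]∉image = All.map⁺ (All.tabulate (λ xs∈ → transfer≢[n] n≥2 (odEu-split xs∈) ∘ sym))

    [n]-isPartition : IsPartition n [ n ]
    [n]-isPartition = isPartition [-] (≤-trans (s≤s z≤n) n≥2 ∷ []) (+-identityʳ n)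

    [n]∷image⊆edOus : [ n ] ∷ map transfer odEus ⊆ edOus
    [n]∷image⊆edOus (here refl) = ∈-edOus⁺ [n]-isPartition ([n]-EdOu n)
    [n]∷image⊆edOus (there zs∈) = transfer-odEus⊆edOus zs∈

theorem3p5 : (∀ (n : ℕ) → pᵒᵈₑᵤ n ≤ pᵉᵈₒᵤ n) × (∀ (n : ℕ) → n ≥ 2 → pᵒᵈₑᵤ n < pᵉᵈₒᵤ n)
theorem3p5 = pᵒᵈₑᵤ≤pᵉᵈₒᵤ , pᵒᵈₑᵤ<pᵉᵈₒᵤ
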